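{- The logic $\mathsf{F}(\mathrm{LTL}[\mathsf{O}])$ can be exponentially more succinct than $\mathrm{LTL}[\mathsf{X},\mathsf{wX},\mathsf{F},\mathsf{G}]$ (over finite traces). That is, there exist finite sets of atomic propositions $AP_n$ and languages $\mathcal{L}_n \subseteq (2^{AP_n})^+$, $n \geq 1$, such that for every $n\ge 1$: (i) there is a formula $\phi \in \mathsf{F}(\mathrm{LTL}[\mathsf{O}])$ with $\mathcal{L}(\phi)=\mathcal{L}_n$ and $\mathrm{size}(\phi)$ bounded by a polynomial in $n$; and (ii) every formula $\psi\in \mathrm{LTL}[\mathsf{X},\mathsf{wX},\mathsf{F},\mathsf{G}]$ with $\mathcal{L}(\psi)=\mathcal{L}_n$ has $\mathrm{size}(\psi) \in 2^{\Omega(n)}$.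
   Context: Let $AP$ be a finite set of atomic propositions and $\Sigma=2^{AP}$. Formulae (in negation normal form) are generated by $\phi ::= p \mid \neg p \mid \phi\lor\phi\mid\phi\land\phi\mid \mathsf{X}\phi\mid\mathsf{wX}\phi\mid\mathsf{F}\phi\mid\mathsf{G}\phi\mid\mathsf{Y}\phi\mid\mathsf{wY}\phi\mid\mathsf{O}\phi\mid\mathsf{H}\phi$ with $p\in AP$. For a finite non-empty trace $\sigma=w_0\cdots w_m\in\Sigma^+$ (so $|\sigma|=m+1$, $\sigma[i]=w_i$) and a position $0\le i<|\sigma|$: $\sigma,i\models p$ iff $p\in\sigma[i]$; $\sigma,i\models\neg p$ iff $p\notin\sigma[i]$; $\lor,\land$ as usual; $\sigma,i\models\mathsf{X}\phi$ iff $i+1<|\sigma|$ and $\sigma,i+1\models\phi$; $\sigma,i\models\mathsf{wX}\phi$ iff $i+1=|\sigma|$ or $\sigma,i+1\models\phi$; $\sigma,i\models\mathsf{F}\phi$ iff $\sigma,j\models\phi$ for some $i\le j<|\sigma|$; $\sigma,i\models\mathsf{G}\phi$ iff $\sigma,j\models\phi$ for all $i\le j<|\sigma|$; $\sigma,i\models\mathsf{Y}\phi$ iff $i>0$ and $\sigma,i-1\models\phi$; $\sigma,i\models\mathsf{wY}\phi$ iff $i=0$ or $\sigma,i-1\models\phi$; $\sigma,i\models\mathsf{O}\phi$ iff $\sigma,j\models\phi$ for some $0\le j\le i$; $\sigma,i\models\mathsf{H}\phi$ iff $\sigma,j\models\phi$ for all $0\le j\le i$. $\sigma\models\phi$ means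 $\sigma,0\models\phi$, and $\mathcal{L}(\phi)=\{\sigma\in\Sigma^+:\sigma\models\phi\}$. Size: $\mathrm{size}(p)=\mathrm{size}(\neg p)=1$, $\mathrm{size}(\circ\phi)=\mathrm{size}(\phi)+1$ for each unary temporal operator $\circ$, $\mathrm{size}(\phi_1\circ\phi_2)=\mathrm{size}(\phi_1)+\mathrm{size}(\phi_2)+1$ for $\circ\in\{\land,\lor\}$. For a set $S$ of temporal operators, $\mathrm{LTL}[S]$ is the set of formulae all of whose temporal operators lie in $S$, and $\mathsf{F}(\mathrm{LTL}[S])$ is the set of formulae of the form $\mathsf{F}(\alpha)$ with $\alpha\in\mathrm{LTL}[S]$. -}

module Defs where

open import Data.Nat using (ℕ; suc; _+_; _*_; _^_) renaming (_≤_ to _≤ⁿ_)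
open import Data.Fin using (Fin; zero; toℕ; _≤_)
open import Data.Fin.Subset using (Subset; _∈_; _∉_)
open import Data.List using (List; foldr; lookup)
open import Data.List.NonEmpty using (List⁺; toList; length)
open import Data.Product using (∃-syntax; _×_)
open import Data.Sum using (_⊎_)
open import Level using (0ℓ)
open import Relation.Binary.PropositionalEquality using (_≡_)
open import Relation.Unary using (Pred)

data TemporalOp : Set where
  X wX F G Y wY O H : TemporalOp

-- A finite set AP of k atomic propositions is represented by Fin k,
-- and the alphabet 2^AP by Subset k.

infixr 6 _∧_
infixr 5 _∨_

data Formula (k : ℕ) : Set where
  atom  : Fin k → Formula k
  natom : Fin k → Formula k
  _∨_   : Formula k → Formula k → Formula k
  _∧_   : Formula k → Formula k → Formula k
  temp  : TemporalOp → Formula k → Formula k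

size : ∀ {k} → Formula k → ℕ
size (atom p)   = 1
size (natom p)  = 1
size (φ ∨ ψ)    = size φ + size ψ + 1
size (φ ∧ ψ)    = size φ + size ψ + 1
size (temp o φ) = size φ + 1

Trace : ℕ → Set
Trace k = List⁺ (Subset k)

Position : ∀ {k} → Trace k → Set
Position σ = Fin (length σ)

_[_] : ∀ {k} (σ : Trace k) → Position σ → Subset k
σ [ i ] = lookup (toList σ) i

infix 4 _,_⊨_ _⊨_

_,_⊨_ : ∀ {k} (σ : Trace k) → Position σ → Formula k → Set
σ , i ⊨ atom p    = p ∈ σ [ i ]
σ , i ⊨ natom p   = p ∉ σ [ i ]
σ , i ⊨ φ ∨ ψ     = (σ , i ⊨ φ) ⊎ (σ , i ⊨ ψ)
σ , i ⊨ φ ∧ ψ     = (σ , i ⊨ φ) × (σ , i ⊨ ψ)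
σ , i ⊨ temp X φ  = ∃[ j ] toℕ j ≡ suc (toℕ i) × (σ , j ⊨ φ)
σ , i ⊨ temp wX φ = suc (toℕ i) ≡ length σ ⊎ (∃[ j ] toℕ j ≡ suc (toℕ i) × (σ , j ⊨ φ))
σ , i ⊨ temp F φ  = ∃[ j ] i ≤ j × (σ , j ⊨ φ)
σ , i ⊨ temp G φ  = ∀ j → i ≤ j → σ , j ⊨ φ
σ , i ⊨ temp Y φ  = ∃[ j ] suc (toℕ j) ≡ toℕ i × (σ , j ⊨ φ)
σ , i ⊨ temp wY φ = toℕ i ≡ 0 ⊎ (∃[ j ] suc (toℕ j) ≡ toℕ i × (σ , j ⊨ φ))
σ , i ⊨ temp O φ  = ∃[ j ] j ≤ i × (σ , j ⊨ φ)
σ , i ⊨ temp H φ  = ∀ j → j ≤ i → σ , j ⊨ φ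

_⊨_ : ∀ {k} → Trace k → Formula k → Set
σ ⊨ φ = σ , zero ⊨ φ

Language : ℕ → Set₁
Language k = Pred (Trace k) 0ℓ

𝓛 : ∀ {k} → Formula k → Language k
𝓛 φ σ = σ ⊨ φ

data LTL[_] (S : Pred TemporalOp 0ℓ) {k : ℕ} : Pred (Formula k) 0ℓ where
  atom  : ∀ p → LTL[ S ] (atom p)
  natom : ∀ p → LTL[ S ] (natom p)
  _∨_   : ∀ {φ ψ} → LTL[ S ] φ → LTL[ S ] ψ → LTL[ S ] (φ ∨ ψ)
  _∧_   : ∀ {φ ψ} → LTL[ S ] φ → LTL[ S ] ψ → LTL[ S ] (φ ∧ ψ)
  temp  : ∀ {o φ} → S o → LTL[ S ] φ → LTL[ S ] (temp o φ)

F⟨LTL[_]⟩ : Pred TemporalOp 0ℓ → ∀ {k} → Pred (Formula k) 0ℓ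
F⟨LTL[ S ]⟩ φ = ∃[ α ] φ ≡ temp F α × LTL[ S ] α

-- Polynomials over ℕ as coefficient lists, constant term first.
Polynomial : Set
Polynomial = List ℕ

eval : Polynomial → ℕ → ℕ
eval p n = foldr (λ a r → a + n * r) 0 p

-- 2 ^ ((c / d) · n) ≤ s, with both sides raised to the d-th power.
2^[_/_·_]≤_ : (c d n s : ℕ) → Set
2^[ c / d · n ]≤ s = 2 ^ (c * n) ≤ⁿ s ^ d

{-# OPTIONS --safe #-}

-- Write t for atom 0 and p_i for atom i + 1.  The language L n consists of the
-- traces with a t-position at which the value of every p_i already occurred at
-- an earlier non-t-position, not necessarily the same for all i.  On traces made
-- of one non-t-letter a followed by t-letters, this says that a occurs among those t-letters up to t, so the
-- 2^(2^n) sets of valuations give pairwise inequivalent suffixes.  By the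
-- expansion laws F φ ≡ φ ∨ X F φ and G φ ≡ φ ∧ wX G φ, the effect of a suffix
-- on a future formula ψ is determined by one bit per subformula, so ψ
-- distinguishes at most 2^(size ψ) suffixes, and therefore 2^n ≤ size ψ.

module Submission where

open import Data.Bool using (T)
open import Data.Fin using (Fin; zero; suc; toℕ)
open import Data.Fin.Properties using (all?; any?; injective⇒≤; *↔×; 2↔Bool) renaming (_≤?_ to _≤ᶠ?_)
open import Data.Fin.Subset using (Subset; _∈_; inside; outside; ⊥)
open import Data.Fin.Subset.Properties using (_∈?_; ⊆-antisym; drop-there)
open import Data.List using (List; []; _∷_; map; filter; allFin)
open import Data.List.Membership.Propositional using () renaming (_∈_ to _∈ˡ_)
open import Data.List.Membership.Propositional.Properties using (∈-allFin; ∈-lookup; ∈-map⁺; ∈-map⁻; ∈-filter⁺; ∈-filter⁻)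
open import Data.List.NonEmpty using (_∷_) renaming (length to length⁺)
open import Data.List.Relation.Unary.All using (All; universal) renaming (lookup to All-lookup)
open import Data.List.Relation.Unary.All.Properties using () renaming (map⁺ to All-map⁺)
open import Data.List.Relation.Unary.Any using (index)
open import Data.List.Relation.Unary.Any.Properties using (lookup-index)
open import Data.Nat using (ℕ; zero; suc; _+_; _*_; _^_; _≤_; z≤n; s≤s) renaming (_≟_ to _≟ⁿ_)
open import Data.Nat.Properties using (≤-reflexive; ≮⇒≥; ≤⇒≯; ^-monoʳ-<; *-identityˡ; ^-identityʳ)
open import Data.Nat.Tactic.RingSolver using (solve-∀)
open import Data.Product using (Σ-syntax; ∃-syntax; _×_; _,_; proj₁; proj₂; uncurry)
open import Data.Product.Function.NonDependent.Propositional using (_×-↔_)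
open import Data.Sum using (inj₁; inj₂) renaming (map to map-⊎)
open import Data.Vec using ([]; _∷_; _++_; uncons; here; there)
open import Data.Vec.Functional using (Vector; foldr)
open import Data.Vec.Properties using (++-injective; ∷-injectiveˡ; ∷-injectiveʳ)
open import Function using (_∘_; _↔_; mk↔ₛ′; Inverse; Injective)
open import Function.Construct.Composition using (_↔-∘_)
open import Function.Properties.Inverse using (Inverse⇒Injection)
open import Function.Construct.Symmetry using (↔-sym)
open import Function.Bundles using (Injection)
open import Relation.Binary.PropositionalEquality using (_≡_; refl; sym; trans; cong; subst; subst₂)
open import Relation.Nullary using (Dec; yes; no; ¬?; _×-dec_; _⊎-dec_; _→-dec_; contradiction)
open import Relation.Nullary.Decidable using (⌊_⌋; toWitness; fromWitness)
open import Relation.Unary using (Pred; _≐_; _∪_; ｛_｝)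
open import Level using (0ℓ)
open import Defs

-- Counting subsets.

Fin[2^m]↔Subset : ∀ m → Fin (2 ^ m) ↔ Subset m
Fin[2^m]↔Subset zero    = mk↔ₛ′ (λ _ → []) (λ _ → zero) (λ { [] → refl }) (λ { zero → refl })
Fin[2^m]↔Subset (suc m) =
  mk↔ₛ′ (uncurry _∷_) uncons (λ { (_ ∷ _) → refl }) (λ _ → refl)
    ↔-∘ ((2↔Bool ×-↔ Fin[2^m]↔Subset m) ↔-∘ *↔×)

subset : ∀ {m} → Fin (2 ^ m) → Subset m
subset {m} = Inverse.to (Fin[2^m]↔Subset m)

subset-injective : ∀ {m} → Injective _≡_ _≡_ (subset {m})
subset-injective {m} = Injection.injective (Inverse⇒Injection (Fin[2^m]↔Subset m))

-- Coding subsets by numbers on both sides gives an injection `Fin (2 ^ m) → Fin (2 ^ s)`, and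
-- `2 ^_` is strictly monotone.
Subset-injective⇒≤ : ∀ {m s} {f : Subset m → Subset s} → Injective _≡_ _≡_ f → m ≤ s
Subset-injective⇒≤ {m} {s} f-injective = ≮⇒≥ λ s<m →
  contradiction (^-monoʳ-< 2 (s≤s (s≤s z≤n)) s<m)
    (≤⇒≯ (injective⇒≤ (subset-injective {m} ∘ f-injective ∘ code-injective)))
  where
  code-injective = Injection.injective (Inverse⇒Injection (↔-sym (Fin[2^m]↔Subset s)))

-- Decidability of satisfaction.

⊨-dec : ∀ {k} (σ : Trace k) i φ → Dec (σ , i ⊨ φ)
⊨-dec σ i (atom p)    = p ∈? (σ [ i ])
⊨-dec σ i (natom p)   = ¬? (p ∈? (σ [ i ]))
⊨-dec σ i (φ ∨ ψ)     = ⊨-dec σ i φ ⊎-dec ⊨-dec σ i ψ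
⊨-dec σ i (φ ∧ ψ)     = ⊨-dec σ i φ ×-dec ⊨-dec σ i ψ
⊨-dec σ i (temp X φ)  = any? λ j → (toℕ j ≟ⁿ suc (toℕ i)) ×-dec ⊨-dec σ j φ
⊨-dec σ i (temp wX φ) = (suc (toℕ i) ≟ⁿ length⁺ σ) ⊎-dec any? λ j → (toℕ j ≟ⁿ suc (toℕ i)) ×-dec ⊨-dec σ j φ
⊨-dec σ i (temp F φ)  = any? λ j → (i ≤ᶠ? j) ×-dec ⊨-dec σ j φ
⊨-dec σ i (temp G φ)  = all? λ j → (i ≤ᶠ? j) →-dec ⊨-dec σ j φ
⊨-dec σ i (temp Y φ)  = any? λ j → (suc (toℕ j) ≟ⁿ toℕ i) ×-dec ⊨-dec σ j φ
⊨-dec σ i (temp wY φ) = (toℕ i ≟ⁿ 0) ⊎-dec any? λ j → (suc (toℕ j) ≟ⁿ toℕ i) ×-dec ⊨-dec σ j φ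
⊨-dec σ i (temp O φ)  = any? λ j → (j ≤ᶠ? i) ×-dec ⊨-dec σ j φ
⊨-dec σ i (temp H φ)  = all? λ j → (j ≤ᶠ? i) →-dec ⊨-dec σ j φ

-- Future formulae ignore earlier letters.

Future : Pred TemporalOp 0ℓ
Future = ｛ X ｝ ∪ ｛ wX ｝ ∪ ｛ F ｝ ∪ ｛ G ｝

pattern ∈X  = inj₁ refl
pattern ∈wX = inj₂ (inj₁ refl)
pattern ∈F  = inj₂ (inj₂ (inj₁ refl))
pattern ∈G  = inj₂ (inj₂ (inj₂ refl))

module _ {k : ℕ} (v : List (Subset k)) where

  -- Future operators never look back: every position reached from `suc j` is again a successor, and
  -- its letter lies in the shared tail `v`.
  head-irrelevant : ∀ {ψ} → LTL[ Future ] ψ → ∀ a b j → (a ∷ v) , suc j ⊨ ψ → (b ∷ v) , suc j ⊨ ψ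
  head-irrelevant (atom p)     a b j h        = h
  head-irrelevant (natom p)    a b j h        = h
  head-irrelevant (φ ∨ ψ)      a b j          = map-⊎ (head-irrelevant φ a b j) (head-irrelevant ψ a b j)
  head-irrelevant (φ ∧ ψ)      a b j (h , h′) = head-irrelevant φ a b j h , head-irrelevant ψ a b j h′
  head-irrelevant (temp ∈X φ)  a b j (suc l , eq , h)        = suc l , eq , head-irrelevant φ a b l h
  head-irrelevant (temp ∈wX φ) a b j (inj₁ eq)               = inj₁ eq
  head-irrelevant (temp ∈wX φ) a b j (inj₂ (suc l , eq , h)) = inj₂ (suc l , eq , head-irrelevant φ a b l h)
  head-irrelevant (temp ∈F φ)  a b j (suc l , j≤l , h)       = suc l , j≤l , head-irrelevant φ a b l h
  head-irrelevant (temp ∈G φ)  a b j h (suc l) j≤l           = head-irrelevant φ a b l (h (suc l) j≤l)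

  X-head-irrelevant : ∀ {ψ} → LTL[ Future ] ψ → ∀ a b → (a ∷ v) ⊨ temp X ψ → (b ∷ v) ⊨ temp X ψ
  X-head-irrelevant ψ a b (suc j , eq , h) = suc j , eq , head-irrelevant ψ a b j h

  wX-head-irrelevant : ∀ {ψ} → LTL[ Future ] ψ → ∀ a b → (a ∷ v) ⊨ temp wX ψ → (b ∷ v) ⊨ temp wX ψ
  wX-head-irrelevant ψ a b = map-⊎ (λ eq → eq) (X-head-irrelevant ψ a b)

-- Expansion laws and signatures.

F-unfold : ∀ {k} (σ : Trace k) {φ} → σ ⊨ temp F φ → σ ⊨ φ ∨ temp X (temp F φ)
F-unfold (a ∷ v)     (zero  , _ , h) = inj₁ h
F-unfold (a ∷ b ∷ v) (suc j , _ , h) = inj₂ (suc zero , refl , suc j , s≤s z≤n , h)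

F-fold : ∀ {k} (σ : Trace k) {φ} → σ ⊨ φ ∨ temp X (temp F φ) → σ ⊨ temp F φ
F-fold σ (inj₁ h)                   = zero , z≤n , h
F-fold σ (inj₂ (_ , _ , j , _ , h)) = j , z≤n , h

G-unfold : ∀ {k} (σ : Trace k) {φ} → σ ⊨ temp G φ → σ ⊨ φ ∧ temp wX (temp G φ)
G-unfold (a ∷ [])    h = h zero z≤n , inj₁ refl
G-unfold (a ∷ b ∷ v) h = h zero z≤n , inj₂ (suc zero , refl , λ j _ → h j z≤n)

G-fold : ∀ {k} (σ : Trace k) {φ} → σ ⊨ φ ∧ temp wX (temp G φ) → σ ⊨ temp G φ
G-fold σ           (h , _)                  zero    _ = h
-- With two letters or more the first disjunct of `wX` is impossible; `l` is known only through
-- `toℕ l ≡ 1`.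
G-fold (a ∷ b ∷ v) (_ , inj₂ (l , eq , h)) (suc j) _ = h (suc j) (subst (_≤ suc (toℕ j)) (sym eq) (s≤s z≤n))

-- The part of a temporal formula that concerns the suffix alone: for `F` and `G` the deferred half
-- of the expansion law, for `X` and `wX` the formula itself.
next : ∀ {k} → TemporalOp → Formula k → Formula k
next F φ = temp X (temp F φ)
next G φ = temp wX (temp G φ)
next o φ = temp o φ

-- Satisfaction of next o φ does not depend on the first letter, so ⊥ is as
-- good as any other; the bits at atoms and Boolean connectives are padding.
signature : ∀ {k} (ψ : Formula k) → List (Subset k) → Subset (size ψ)
signature (atom p)   v = outside ∷ []
signature (natom p)  v = outside ∷ []
signature (φ ∨ ψ)    v = (signature φ v ++ signature ψ v) ++ outside ∷ []
signature (φ ∧ ψ)    v = (signature φ v ++ signature ψ v) ++ outside ∷ []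
signature (temp o φ) v = signature φ v ++ ⌊ ⊨-dec (⊥ ∷ v) zero (next o φ) ⌋ ∷ []

⌊⌋-transfer : ∀ {A B : Set} (a? : Dec A) (b? : Dec B) → ⌊ a? ⌋ ≡ ⌊ b? ⌋ → A → B
⌊⌋-transfer a? b? eq a = toWitness {a? = b?} (subst T eq (fromWitness {a? = a?} a))

module _ {k : ℕ} {v w : List (Subset k)} where

  -- Induction on `ψ`: the signatures of subformulae are segments of fixed length, so `++-injective`
  -- splits the equation. One implication is enough, as the equation is symmetric in `v` and `w`.
  signature-determines : ∀ {ψ} → LTL[ Future ] ψ → signature ψ v ≡ signature ψ w →
                         ∀ a → (a ∷ v) ⊨ ψ → (a ∷ w) ⊨ ψ

  next-determined : ∀ {o φ} → signature (temp o φ) v ≡ signature (temp o φ) w →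
                    (⊥ ∷ v) ⊨ next o φ → (⊥ ∷ w) ⊨ next o φ
  next-determined {o} {φ} eq =
    ⌊⌋-transfer (⊨-dec (⊥ ∷ v) zero (next o φ)) (⊨-dec (⊥ ∷ w) zero (next o φ))
      (∷-injectiveˡ (proj₂ (++-injective (signature φ v) (signature φ w) eq)))

  signature-determines (atom p)  eq a h = h
  signature-determines (natom p) eq a h = h
  signature-determines (_∨_ {φ} {ψ} φ∈ ψ∈) eq a =
    let eq₁ , eq₂ = ++-injective (signature φ v) (signature φ w) (proj₁ (++-injective _ _ eq))
    in map-⊎ (signature-determines φ∈ eq₁ a) (signature-determines ψ∈ eq₂ a)
  signature-determines (_∧_ {φ} {ψ} φ∈ ψ∈) eq a (h , h′) =
    let eq₁ , eq₂ = ++-injective (signature φ v) (signature φ w) (proj₁ (++-injective _ _ eq))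
    in signature-determines φ∈ eq₁ a h , signature-determines ψ∈ eq₂ a h′
  signature-determines (temp {φ = φ} ∈X φ∈) eq a h =
    -- The stored bit speaks of the head `⊥`, so `a` is exchanged for `⊥` in front of `v` and
    -- restored in front of `w`.
    X-head-irrelevant w φ∈ ⊥ a (next-determined {X} {φ} eq (X-head-irrelevant v φ∈ a ⊥ h))
  signature-determines (temp {φ = φ} ∈wX φ∈) eq a h =
    wX-head-irrelevant w φ∈ ⊥ a (next-determined {wX} {φ} eq (wX-head-irrelevant v φ∈ a ⊥ h))
  signature-determines (temp {φ = φ} ∈F φ∈) eq a h =
    -- After unfolding, only the immediate disjunct depends on `a`, and induction covers it; the
    -- deferred one is read off the bit.
    F-fold (a ∷ w) (map-⊎
      (signature-determines φ∈ (proj₁ (++-injective _ _ eq)) a)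
      (λ h′ → X-head-irrelevant w (temp ∈F φ∈) ⊥ a
                (next-determined {F} {φ} eq (X-head-irrelevant v (temp ∈F φ∈) a ⊥ h′)))
      (F-unfold (a ∷ v) h))
  signature-determines (temp {φ = φ} ∈G φ∈) eq a h =
    let h₀ , h₁ = G-unfold (a ∷ v) h
    in G-fold (a ∷ w)
         ( signature-determines φ∈ (proj₁ (++-injective _ _ eq)) a h₀
         , wX-head-irrelevant w (temp ∈G φ∈) ⊥ a
             (next-determined {G} {φ} eq (wX-head-irrelevant v (temp ∈G φ∈) a ⊥ h₁)))

-- The succinct formula.

-- The syntax has no constant for truth, so the fold ends in a given formula.
⋀ : ∀ {k m} → Vector (Formula k) m → Formula k → Formula k
⋀ φs φ = foldr _∧_ φ φs

⋀-elim : ∀ {k m} {σ : Trace k} {j} (φs : Vector (Formula k) m) {φ} →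
         σ , j ⊨ ⋀ φs φ → (σ , j ⊨ φ) × (∀ i → σ , j ⊨ φs i)
⋀-elim {m = zero}  φs h       = h , λ ()
⋀-elim {m = suc m} φs (h , t) with ⋀-elim (φs ∘ suc) t
... | hφ , hs = hφ , λ { zero → h ; (suc i) → hs i }

⋀-intro : ∀ {k m} {σ : Trace k} {j} (φs : Vector (Formula k) m) {φ} →
          σ , j ⊨ φ → (∀ i → σ , j ⊨ φs i) → σ , j ⊨ ⋀ φs φ
⋀-intro {m = zero}  φs h hs = h
⋀-intro {m = suc m} φs h hs = hs zero , ⋀-intro (φs ∘ suc) h (hs ∘ suc)

⋀-LTL : ∀ {S k m} (φs : Vector (Formula k) m) {φ} →
        LTL[ S ] φ → (∀ i → LTL[ S ] (φs i)) → LTL[ S ] (⋀ φs φ)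
⋀-LTL {m = zero}  φs h hs = h
⋀-LTL {m = suc m} φs h hs = hs zero ∧ ⋀-LTL (φs ∘ suc) h (hs ∘ suc)

⋀-size : ∀ {k m s} (φs : Vector (Formula k) m) {φ} →
         (∀ i → size (φs i) ≡ s) → size (⋀ φs φ) ≡ m * (s + 1) + size φ
⋀-size {m = zero}  φs hs = refl
⋀-size {m = suc m} {s} φs {φ} hs
  rewrite hs zero | ⋀-size (φs ∘ suc) {φ} (hs ∘ suc) = rearrange s (m * (s + 1)) (size φ)
  where
  rearrange : ∀ a b c → a + (b + c) + 1 ≡ a + 1 + b + c
  rearrange = solve-∀

-- `O` includes the present, but `repeats` also demands `t` there, so the `natom zero` witness is
-- strictly earlier.
agrees : ∀ {n} → Fin n → Formula (suc n)
agrees i = (atom (suc i)  ∧ temp O (natom zero ∧ atom (suc i)))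
         ∨ (natom (suc i) ∧ temp O (natom zero ∧ natom (suc i)))

repeats : ∀ n → Formula (suc n)
repeats n = ⋀ agrees (atom zero)

repeats-LTL : ∀ n → LTL[ ｛ O ｝ ] (repeats n)
repeats-LTL n = ⋀-LTL agrees (atom zero) λ i →
    (atom (suc i)  ∧ temp refl (natom zero ∧ atom (suc i)))
  ∨ (natom (suc i) ∧ temp refl (natom zero ∧ natom (suc i)))

F-repeats-size : ∀ n → size (temp F (repeats n)) ≡ eval (2 ∷ 14 ∷ []) n
-- Each `agrees i` has size 13 and costs one more for its conjunction; `atom zero` and `F` add 2.
F-repeats-size n rewrite ⋀-size {m = n} agrees {atom zero} (λ _ → refl) = rearrange n
  where
  rearrange : ∀ n → n * 14 + 1 + 1 ≡ 2 + n * (14 + n * 0)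
  rearrange = solve-∀

-- Traces whose only non-`t`-letter is the head.

zero∈⇒inside : ∀ {n} {p : Subset (suc n)} → zero ∈ p → ∃[ b ] p ≡ inside ∷ b
zero∈⇒inside {p = _ ∷ b} here = b , refl

module _ {n : ℕ} {a : Subset n} {v : List (Subset (suc n))} (all-t : All (zero ∈_) v) where

  private
    σ : Trace (suc n)
    σ = (outside ∷ a) ∷ v

  -- All letters of `v` contain `t`, so the past witness can only be the head. This forces the
  -- separate `O` in each `agrees i` to refer to one and the same letter.
  O¬t⇒head : ∀ {j φ} → σ , j ⊨ temp O (natom zero ∧ φ) → σ ⊨ φ
  O¬t⇒head (zero  , _ , _ , h)  = h
  O¬t⇒head (suc l , _ , ¬t , _) = contradiction (All-lookup all-t (∈-lookup l)) ¬t

  head⇒O¬t : ∀ {j φ} → σ ⊨ φ → σ , j ⊨ temp O (natom zero ∧ φ)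
  head⇒O¬t h = zero , z≤n , (λ ()) , h

  agrees-everywhere : ∀ {j b} → σ [ j ] ≡ inside ∷ b → (∀ i → σ , j ⊨ agrees i) → a ≡ b
  agrees-everywhere {j} {b} eq hs = ⊆-antisym a⊆b b⊆a
    where
    a⊆b : ∀ {i} → i ∈ a → i ∈ b
    a⊆b {i} i∈a with hs i
    ... | inj₁ (i∈ , _) = drop-there (subst (suc i ∈_) eq i∈)
    ... | inj₂ (_ , o)  = contradiction (there i∈a) (O¬t⇒head {j} {natom (suc i)} o)
    b⊆a : ∀ {i} → i ∈ b → i ∈ a
    b⊆a {i} i∈b with hs i
    ... | inj₁ (_ , o)  = drop-there (O¬t⇒head {j} {atom (suc i)} o)
    ... | inj₂ (i∉ , _) = contradiction (subst (suc i ∈_) (sym eq) (there i∈b)) i∉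

  F-repeats⇒∈ : σ ⊨ temp F (repeats n) → (inside ∷ a) ∈ˡ v
  F-repeats⇒∈ (j , _ , h) with ⋀-elim {σ = σ} {j} agrees h
  -- The head lacks `t`, so the witness of `F` lies in `v`.
  F-repeats⇒∈ (zero  , _ , _) | () , _
  F-repeats⇒∈ (suc l , _ , _) | t , hs with zero∈⇒inside t
  ... | b , eq =
    subst (_∈ˡ v) (trans eq (cong (inside ∷_) (sym (agrees-everywhere {suc l} eq hs)))) (∈-lookup l)

  ∈⇒F-repeats : (inside ∷ a) ∈ˡ v → σ ⊨ temp F (repeats n)
  ∈⇒F-repeats a∈v = j , z≤n , ⋀-intro {σ = σ} {j} agrees (subst (zero ∈_) eq here) agree
    where
    j : Position σ
    j = suc (index a∈v)
    eq : inside ∷ a ≡ σ [ j ]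
    eq = lookup-index a∈v
    agree : ∀ i → σ , j ⊨ agrees i
    agree i with i ∈? a
    ... | yes i∈a =
      inj₁ (subst (suc i ∈_) eq (there i∈a) , head⇒O¬t {j} {atom (suc i)} (there i∈a))
    ... | no i∉a =
      inj₂ ((λ i∈ → i∉a (drop-there (subst (suc i ∈_) (sym eq) i∈)))
           , head⇒O¬t {j} {natom (suc i)} (i∉a ∘ drop-there))

-- Suffixes coding sets of valuations, and the lower bound.

-- A set of valuations is coded as a `Subset (2 ^ n)` through `subset`, so that such sets can be
-- counted against signatures.
suffix : ∀ n → Subset (2 ^ n) → List (Subset (suc n))
suffix n V = map (λ x → inside ∷ subset x) (filter (_∈? V) (allFin (2 ^ n)))

module _ (n : ℕ) (V : Subset (2 ^ n)) where

  suffix-t : All (zero ∈_) (suffix n V)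
  suffix-t = All-map⁺ (universal (λ _ → here) (filter (_∈? V) (allFin (2 ^ n))))

  ∈⇒∈-suffix : ∀ {x} → x ∈ V → (inside ∷ subset x) ∈ˡ suffix n V
  ∈⇒∈-suffix {x} x∈V = ∈-map⁺ _ (∈-filter⁺ (_∈? V) (∈-allFin x) x∈V)

  ∈-suffix⇒∈ : ∀ {x} → (inside ∷ subset x) ∈ˡ suffix n V → x ∈ V
  ∈-suffix⇒∈ x∈ with ∈-map⁻ _ x∈
  ... | y , y∈ , eq =
    subst (_∈ V) (subset-injective {n} (sym (∷-injectiveʳ eq)))
      (proj₂ (∈-filter⁻ (_∈? V) {xs = allFin (2 ^ n)} y∈))

module _ {n : ℕ} {ψ : Formula (suc n)} (ψ∈ : LTL[ Future ] ψ) (ψ≐ : 𝓛 ψ ≐ 𝓛 (temp F (repeats n))) where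

  -- Prepending `outside ∷ subset x` asks a suffix whether its set contains `x`; by the equal
  -- signatures a positive answer of `ψ` for `V` carries over to `W`.
  signature-⊆ : ∀ {V W : Subset (2 ^ n)} → signature ψ (suffix n V) ≡ signature ψ (suffix n W) →
                ∀ {x} → x ∈ V → x ∈ W
  signature-⊆ {V} {W} eq {x} x∈V =
    ∈-suffix⇒∈ n W (F-repeats⇒∈ (suffix-t n W) (proj₁ ψ≐ (signature-determines ψ∈ eq (outside ∷ subset x)
      (proj₂ ψ≐ (∈⇒F-repeats (suffix-t n V) (∈⇒∈-suffix n V x∈V))))))

  2^n≤size : 2 ^ n ≤ size ψ
  2^n≤size = Subset-injective⇒≤ {f = signature ψ ∘ suffix n} λ eq →
    ⊆-antisym (signature-⊆ eq) (signature-⊆ (sym eq))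

theorem1 : Σ[ AP ∈ (ℕ → ℕ) ] Σ[ L ∈ ((n : ℕ) → Language (AP n)) ]
    (Σ[ P ∈ Polynomial ]
    (∀ n → 1 ≤ n →
    Σ[ φ ∈ Formula (AP n) ]
    F⟨LTL[ ｛ O ｝ ]⟩ φ × 𝓛 φ ≐ L n × size φ ≤ eval P n))
    ×
    (Σ[ c ∈ ℕ ] Σ[ d ∈ ℕ ] Σ[ n₀ ∈ ℕ ] 1 ≤ c × 1 ≤ d ×
    (∀ n → 1 ≤ n → n₀ ≤ n →
    (ψ : Formula (AP n)) →
    LTL[ ｛ X ｝ ∪ ｛ wX ｝ ∪ ｛ F ｝ ∪ ｛ G ｝ ] ψ → 𝓛 ψ ≐ L n →
    2^[ c / d · n ]≤ size ψ))
theorem1 =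
    suc
  , (λ n → 𝓛 (temp F (repeats n)))
  , ( 2 ∷ 14 ∷ []
    , λ n _ → temp F (repeats n)
            , (repeats n , refl , repeats-LTL n)
            , ((λ h → h) , (λ h → h))
            , ≤-reflexive (F-repeats-size n))
  -- The bound `2 ^ n ≤ size ψ` holds for every `n`, so `c = d = 1` and `n₀ = 0`; `subst₂` only
  -- restores `1 * n` and `size ψ ^ 1`.
  , 1 , 1 , 0 , s≤s z≤n , s≤s z≤n
  , λ n _ _ ψ ψ∈ ψ≐ → subst₂ _≤_ (cong (2 ^_) (sym (*-identityˡ n))) (sym (^-identityʳ (size ψ))) (2^n≤size ψ∈ ψ≐)
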